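{- Let $D'\geq 3$ and $n'\geq 1$ be integers with $n'\geq D'\cdot 2^{12}/3$. Then there exists a connected port-labeled graph $G$ with at most $n'$ nodes and diameter at most $D'$ which contains two nodes $a,b$ such that $\mathcal{V}(a)\neq\mathcal{V}(b)$, but $\mathcal{V}_t(a)=\mathcal{V}_t(b)$ for every integer $t$ with $0\le t\leq \frac{D'-5}{6}\log_2\frac{n'}{D'}-0.41D'$.
   Context: A port-labeled graph is a simple undirected graph $G$ in which, for every node $v$ of degree $k=\deg_G(v)$, the edges incident to $v$ are labeled bijectively by the port numbers $\{1,\ldots,k\}$; write $\lambda(u,v)$ for the port number at $u$ of the edge $\{u,v\}$. The truncated view $\mathcal{V}_l(v)$ of a node $v$ is the rooted port-labeled tree defined recursively: $\mathcal{V}_0(v)$ is a single root node $x_0$; $\mathcal{V}_{l+1}(v)$ has root $x_0$ with one child $x_i$ for each neighbor $v_i$ of $v$, the tree edge $\{x_0,x_i\}$ carrying port number $\lambda(v,v_i)$ at $x_0$ and $\lambda(v_i,v)$ at $x_i$, and the subtree rooted at $x_i$ is $\mathcal{V}_l(v_i)$. The view $\mathcal{V}(v)$ is the infinite rooted port-labeled tree whose truncation to depth $l$ is $\mathcal{V}_l(v)$ for every $l\ge 0$. The diameter of $G$ is the maximum over pairs of nodes of their shortest-path distance. -}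

module Defs where

open import Data.Nat using (ℕ; zero; suc; _+_; _*_; _∸_; _^_; _≤_; _<_)
open import Data.Fin using (Fin; toℕ)
open import Data.Vec using (Vec; tabulate; [])
open import Data.Product using (_×_; _,_; ∃-syntax)
open import Relation.Binary.PropositionalEquality using (_≡_; _≢_)

-- A (finite, simple, undirected) port-labeled graph on the node set Fin n.
-- Port numbers {1,…,k} at a node of degree k are represented by Fin k
-- (port i+1 ↦ i).  nbr v p is the neighbour reached from v through port p;
-- back v p is the port number λ(nbr v p, v) of the same edge at the other end.
record PortGraph (n : ℕ) : Set where
  field
    deg     : Fin n → ℕ
    nbr     : (v : Fin n) → Fin (deg v) → Fin n
    back    : (v : Fin n) (p : Fin (deg v)) → Fin (deg (nbr v p))
    back-ok : (v : Fin n) (p : Fin (deg v)) → nbr (nbr v p) (back v p) ≡ v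
    noLoop  : (v : Fin n) (p : Fin (deg v)) → nbr v p ≢ v
    noMulti : (v : Fin n) (p q : Fin (deg v)) → nbr v p ≡ nbr v q → p ≡ q

open PortGraph public

data Walk {n : ℕ} (G : PortGraph n) : Fin n → Fin n → ℕ → Set where
  here : (v : Fin n) → Walk G v v zero
  step : {v w : Fin n} {k : ℕ} (p : Fin (deg G v)) →
         Walk G (nbr G v p) w k → Walk G v w (suc k)

Connected : {n : ℕ} → PortGraph n → Set
Connected {n} G = (u v : Fin n) → ∃[ k ] Walk G u v k

DiameterAtMost : {n : ℕ} → PortGraph n → ℕ → Set
DiameterAtMost {n} G D = (u v : Fin n) → ∃[ k ] (k ≤ D × Walk G u v k)

-- Rooted port-labeled trees: a node with k children; the i-th entry
-- (i ∈ Fin k, i.e. port i+1 at the root) holds the port number (0-based)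
-- of that edge at the child, and the subtree rooted at the child.
data Tree : Set where
  node : (k : ℕ) → Vec (ℕ × Tree) k → Tree

view : {n : ℕ} → PortGraph n → ℕ → Fin n → Tree
view G zero v = node 0 []
view G (suc l) v =
  node (deg G v) (tabulate λ p → (toℕ (back G v p) , view G l (nbr G v p)))

-- Exact natural-number rendering of the real inequality
--   t ≤ ((D - 5)/6) · log₂ (n / D) - 0.41 · D     (n, D ≥ 1):
-- multiplied by 600:  600 t + 246 D ≤ 100 (D - 5) log₂ (n / D).
-- If D ≤ 5 the right side is ≤ 0 < left side (as n/D > 1 under the hypotheses),
-- so no t qualifies; if D > 5, with c = 100 (D - 5) > 0 it is equivalent to
--   2^(600 t + 246 D) · D^c ≤ n^c.
TimeBound : ℕ → ℕ → ℕ → Set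
TimeBound D n t =
  5 < D × 2 ^ (600 * t + 246 * D) * D ^ (100 * (D ∸ 5)) ≤ n ^ (100 * (D ∸ 5))

{-# OPTIONS --safe #-}
module Submission where

-- Take D' blocks in a cycle, each a copy of {0,1}^K, and join consecutive blocks completely: a port
-- carries a direction and a mask, and moving along it xors the mask into the node.  Coordinates are
-- carried along unchanged, except that crossing from the last block to block 0 shifts them cyclically,
-- so that the coordinate c at the block i sits at the position i + c D' of a cycle of length K D'.
-- The only asymmetry is that at the nodes of block 0 whose coordinate 0 is 1, the two directions are
-- interchanged; this reveals the coordinate at position 0 only.  Information about coordinates travels
-- along the long cycle at speed 1, so a coordinate at distance r from position 0 does not influence
-- the views of depth r - 1, whereas the infinite view determines all of them.  Going round the cycle
-- of blocks once, every node is reached within D' steps.  With K = 2h + 1, coordinate h of block 0 is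
-- at distance h D' from position 0, and h is chosen maximal with D' 2^K ≤ n'.

open import Defs
open import Data.Nat using (ℕ; zero; suc; _+_; _*_; _∸_; _^_; _≤_; _<_; z≤n; s≤s; NonZero; >-nonZero)
open import Data.Nat.Properties hiding (_≟_)
open import Data.Nat.Solver using (module +-*-Solver)
open import Data.Fin using (Fin; zero; suc; toℕ; fromℕ; inject₁; opposite; finToFun; funToFin; combine; _↑ˡ_)
open import Data.Fin.Properties
  using (_≟_; toℕ-injective; toℕ-inject₁; toℕ-fromℕ; toℕ-↑ˡ; toℕ≤pred[n];
         finToFun-funToFin; funToFin-finToFin; *↔×)
open import Data.Vec using (lookup; tabulate)
open import Data.Vec.Properties using (tabulate-cong; lookup∘tabulate)
open import Data.Product using (_×_; _,_; proj₁; proj₂; ∃-syntax)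
open import Data.Product.Properties using (,-injectiveˡ; ,-injectiveʳ)
open import Data.Sum using (_⊎_; inj₁; inj₂)
open import Function using (_∘_; _↔_; Inverse)
open import Relation.Binary.PropositionalEquality
open import Relation.Nullary using (¬_; Dec; yes; no; contradiction)

-- Regular graphs with abstract nodes and ports, and their views.

node-injective : ∀ {k xs ys} → node k xs ≡ node k ys → xs ≡ ys
node-injective refl = refl

tabulate-injective : ∀ {A : Set} {n} {f g : Fin n → A} → tabulate f ≡ tabulate g → f ≗ g
tabulate-injective {f = f} {g} eq p = begin
  f p                   ≡⟨ lookup∘tabulate f p ⟨
  lookup (tabulate f) p ≡⟨ cong (λ v → lookup v p) eq ⟩
  lookup (tabulate g) p ≡⟨ lookup∘tabulate g p ⟩
  g p                   ∎
  where open ≡-Reasoning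

-- All nodes share one port type, so `reverse` is free of the dependent types that `back` carries.
record RegularGraph (V P : Set) : Set where
  field
    next           : V → P → V
    reverse        : V → P → P
    next-reverse   : ∀ v p → next (next v p) (reverse v p) ≡ v
    next-irrefl    : ∀ v p → next v p ≢ v
    next-injective : ∀ v p q → next v p ≡ next v q → p ≡ q

module Encoding {V P : Set} {n d : ℕ} (H : RegularGraph V P)
                (V-code : Fin n ↔ V) (P-code : Fin d ↔ P) where
  open RegularGraph H
  open Inverse V-code using ()
    renaming (to to decodeV; from to encodeV; strictlyInverseˡ to decodeV-encodeV; strictlyInverseʳ to encodeV-decodeV)
  open Inverse P-code using ()
    renaming (to to decodeP; from to encodeP; strictlyInverseˡ to decodeP-encodeP; strictlyInverseʳ to encodeP-decodeP)

  encodeP-injective : ∀ {p q} → encodeP p ≡ encodeP q → p ≡ q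
  encodeP-injective {p} {q} eq = trans (sym (decodeP-encodeP p)) (trans (cong decodeP eq) (decodeP-encodeP q))

  encodeV-injective : ∀ {p q} → encodeV p ≡ encodeV q → p ≡ q
  encodeV-injective {p} {q} eq = trans (sym (decodeV-encodeV p)) (trans (cong decodeV eq) (decodeV-encodeV q))

  decodeP-injective : ∀ {p q} → decodeP p ≡ decodeP q → p ≡ q
  decodeP-injective {p} {q} eq = trans (sym (encodeP-decodeP p)) (trans (cong encodeP eq) (encodeP-decodeP q))

  graph : PortGraph n
  graph = record
    { deg     = λ _ → d
    ; nbr     = λ v p → encodeV (next (decodeV v) (decodeP p))
    ; back    = λ v p → encodeP (reverse (decodeV v) (decodeP p))
    ; back-ok = λ v p → trans
        (cong encodeV (trans (cong₂ next (decodeV-encodeV _) (decodeP-encodeP _)) (next-reverse _ _)))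
        (encodeV-decodeV v)
    ; noLoop  = λ v p eq → next-irrefl (decodeV v) (decodeP p) (trans (sym (decodeV-encodeV _)) (cong decodeV eq))
    ; noMulti = λ v p q eq → decodeP-injective (next-injective _ _ _ (encodeV-injective eq))
    }

  walk-step : ∀ {w k} u p → Walk graph (encodeV (next u p)) w k → Walk graph (encodeV u) w (suc k)
  walk-step {w} {k} u p walk = step (encodeP p) (subst (λ v → Walk graph (encodeV v) w k)
    (sym (cong₂ next (decodeV-encodeV u) (decodeP-encodeP p))) walk)

  -- `R` is a bisimulation graded by the remaining depth: following an edge may weaken it by one
  -- level, since the subtrees of a truncated view are one level shallower.
  view-cong : {R : ℕ → V → V → Set} →
    (∀ {t u v} → R (suc t) u v → ∀ p → reverse u p ≡ reverse v p × R t (next u p) (next v p)) →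
    ∀ t {u v} → R t u v → view graph t (encodeV u) ≡ view graph t (encodeV v)
  view-cong R-step zero    r = refl
  view-cong {R} R-step (suc t) {u} {v} r rewrite decodeV-encodeV u | decodeV-encodeV v =
    cong (node d) (tabulate-cong λ p → let eq , r′ = R-step r (decodeP p) in
      cong₂ _,_ (cong (toℕ ∘ encodeP) eq) (view-cong {R} R-step t r′))

  Indistinguishable : V → V → Set
  Indistinguishable u v = ∀ l → view graph l (encodeV u) ≡ view graph l (encodeV v)

  view-suc-injective : ∀ l u v p → view graph (suc l) (encodeV u) ≡ view graph (suc l) (encodeV v) →
    reverse u p ≡ reverse v p × view graph l (encodeV (next u p)) ≡ view graph l (encodeV (next v p))
  view-suc-injective l u v p eq
    with entries ← tabulate-injective (node-injective eq) (encodeP p)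
    rewrite decodeV-encodeV u | decodeV-encodeV v | decodeP-encodeP p =
    encodeP-injective (toℕ-injective (,-injectiveˡ entries)) , ,-injectiveʳ entries

  indistinguishable-reverse : ∀ {u v} → Indistinguishable u v → ∀ p → reverse u p ≡ reverse v p
  indistinguishable-reverse ind p = proj₁ (view-suc-injective 0 _ _ p (ind 1))

  indistinguishable-next : ∀ {u v} → Indistinguishable u v → ∀ p → Indistinguishable (next u p) (next v p)
  indistinguishable-next ind p l = proj₂ (view-suc-injective l _ _ p (ind (suc l)))

-- Predecessor and successor on a cycle.

predᶜ : ∀ {n} → Fin (suc n) → Fin (suc n)
predᶜ zero    = fromℕ _
predᶜ (suc i) = inject₁ i

-- Extends a successor to a cycle with one more point: `zero` means wrapping around and stays, every
-- other value moves up by one.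
skip-one : ∀ {n} → Fin (suc n) → Fin (suc (suc n))
skip-one zero    = zero
skip-one (suc i) = suc (suc i)

sucᶜ : ∀ {n} → Fin (suc n) → Fin (suc n)
sucᶜ {zero}  i       = i
sucᶜ {suc n} zero    = suc zero
sucᶜ {suc n} (suc i) = skip-one (sucᶜ i)

sucᶜ-fromℕ : ∀ n → sucᶜ (fromℕ n) ≡ zero
sucᶜ-fromℕ zero    = refl
sucᶜ-fromℕ (suc n) = cong skip-one (sucᶜ-fromℕ n)

sucᶜ-inject₁ : ∀ {n} (i : Fin n) → sucᶜ (inject₁ i) ≡ suc i
sucᶜ-inject₁ zero    = refl
sucᶜ-inject₁ (suc i) = cong skip-one (sucᶜ-inject₁ i)

sucᶜ-predᶜ : ∀ {n} (i : Fin (suc n)) → sucᶜ (predᶜ i) ≡ i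
sucᶜ-predᶜ zero    = sucᶜ-fromℕ _
sucᶜ-predᶜ (suc i) = sucᶜ-inject₁ i

predᶜ-skip-one : ∀ {n} (i : Fin (suc n)) → predᶜ (skip-one i) ≡ suc (predᶜ i)
predᶜ-skip-one zero    = refl
predᶜ-skip-one (suc i) = refl

predᶜ-sucᶜ : ∀ {n} (i : Fin (suc n)) → predᶜ (sucᶜ i) ≡ i
predᶜ-sucᶜ {zero}  zero    = refl
predᶜ-sucᶜ {suc n} zero    = refl
predᶜ-sucᶜ {suc n} (suc i) = trans (predᶜ-skip-one (sucᶜ i)) (cong suc (predᶜ-sucᶜ i))

predᶜ-irrefl : ∀ {n} (i : Fin (suc (suc n))) → predᶜ i ≢ i
predᶜ-irrefl (suc i) eq = 1+n≢n (trans (cong toℕ (sym eq)) (toℕ-inject₁ i))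

sucᶜ-irrefl : ∀ {n} (i : Fin (suc (suc n))) → sucᶜ i ≢ i
sucᶜ-irrefl i eq = predᶜ-irrefl i (trans (cong predᶜ (sym eq)) (predᶜ-sucᶜ i))

predᶜ≢sucᶜ : ∀ {n} (i : Fin (suc (suc (suc n)))) → predᶜ i ≢ sucᶜ i
predᶜ≢sucᶜ i eq = predᶜ-predᶜ i (trans (cong predᶜ eq) (predᶜ-sucᶜ i))
  where
  predᶜ-predᶜ : ∀ {n} (i : Fin (suc (suc (suc n)))) → predᶜ (predᶜ i) ≢ i
  predᶜ-predᶜ (suc (suc i)) eq = m+1+n≢n 1 (begin
    suc (suc (toℕ i))          ≡⟨ cong toℕ eq ⟨
    toℕ (inject₁ (inject₁ i))  ≡⟨ toℕ-inject₁ (inject₁ i) ⟩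
    toℕ (inject₁ i)            ≡⟨ toℕ-inject₁ i ⟩
    toℕ i                      ∎)
    where open ≡-Reasoning

predᶜ^ : ∀ {n} → ℕ → Fin (suc n) → Fin (suc n)
predᶜ^ zero    i = i
predᶜ^ (suc s) i = predᶜ^ s (predᶜ i)

predᶜ^-+ : ∀ {n} s r (i : Fin (suc n)) → predᶜ^ (s + r) i ≡ predᶜ^ r (predᶜ^ s i)
predᶜ^-+ zero    r i = refl
predᶜ^-+ (suc s) r i = predᶜ^-+ s r (predᶜ i)

predᶜ^-≤ : ∀ {n} s (i j : Fin (suc n)) → toℕ i ≡ s + toℕ j → predᶜ^ s i ≡ j
predᶜ^-≤ zero    i       j eq = toℕ-injective eq
predᶜ^-≤ (suc s) (suc i) j eq = predᶜ^-≤ s (inject₁ i) j (trans (toℕ-inject₁ i) (suc-injective eq))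

-- At least one step is demanded because only a step can change the code of a node. For `i ≤ j` the
-- route passes through zero and the last point; `i ≡ j` takes a full turn.
predᶜ^-transitive : ∀ {n} (i j : Fin (suc n)) → ∃[ s ] (s ≤ n × predᶜ^ (suc s) i ≡ j)
predᶜ^-transitive {n} i j with toℕ i ≤? toℕ j
... | yes i≤j = toℕ i + (n ∸ toℕ j) , bound , (begin
    predᶜ^ (suc (toℕ i + (n ∸ toℕ j))) i          ≡⟨ cong (λ s → predᶜ^ s i) (+-suc (toℕ i) _) ⟨
    predᶜ^ (toℕ i + suc (n ∸ toℕ j)) i            ≡⟨ predᶜ^-+ (toℕ i) _ i ⟩
    predᶜ^ (suc (n ∸ toℕ j)) (predᶜ^ (toℕ i) i)   ≡⟨ cong (predᶜ^ (suc (n ∸ toℕ j))) (predᶜ^-≤ (toℕ i) i zero (sym (+-identityʳ _))) ⟩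
    predᶜ^ (n ∸ toℕ j) (fromℕ n)                  ≡⟨ predᶜ^-≤ (n ∸ toℕ j) (fromℕ n) j (trans (toℕ-fromℕ n) (sym (m∸n+n≡m (toℕ≤pred[n] j)))) ⟩
    j                                             ∎)
  where
  open ≡-Reasoning
  bound : toℕ i + (n ∸ toℕ j) ≤ n
  bound = ≤-trans (+-monoˡ-≤ (n ∸ toℕ j) i≤j) (≤-reflexive (m+[n∸m]≡n (toℕ≤pred[n] j)))
... | no i≰j with s , eq ← m≤n⇒∃[o]m+o≡n (≰⇒> i≰j) =
    s , ≤-trans (m≤n+m s (toℕ j)) (≤-trans (n≤1+n _) (subst (_≤ n) (sym eq) (toℕ≤pred[n] i)))
      , predᶜ^-≤ (suc s) i j (trans (sym eq) (cong suc (+-comm (toℕ j) s)))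

-- Bit vectors and exclusive or.

funToFin-cong : ∀ {m n} {f g : Fin m → Fin n} → f ≗ g → funToFin f ≡ funToFin g
funToFin-cong {zero}  f≗g = refl
funToFin-cong {suc m} f≗g = cong₂ combine (f≗g zero) (funToFin-cong (f≗g ∘ suc))

_⊕_ : Fin 2 → Fin 2 → Fin 2
zero     ⊕ b = b
suc zero ⊕ b = opposite b

⊕-cancelʳ : ∀ a b → (a ⊕ b) ⊕ b ≡ a
⊕-cancelʳ zero       zero       = refl
⊕-cancelʳ zero       (suc zero) = refl
⊕-cancelʳ (suc zero) zero       = refl
⊕-cancelʳ (suc zero) (suc zero) = refl

⊕-cancelˡ : ∀ a b → a ⊕ (a ⊕ b) ≡ b
⊕-cancelˡ zero       b          = refl
⊕-cancelˡ (suc zero) zero       = refl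
⊕-cancelˡ (suc zero) (suc zero) = refl

⊕-injectiveˡ : ∀ {a a′} b → a ⊕ b ≡ a′ ⊕ b → a ≡ a′
⊕-injectiveˡ {a} {a′} b eq = trans (sym (⊕-cancelʳ a b)) (trans (cong (_⊕ b) eq) (⊕-cancelʳ a′ b))

⊕-injectiveʳ : ∀ a {b b′} → a ⊕ b ≡ a ⊕ b′ → b ≡ b′
⊕-injectiveʳ a {b} {b′} eq = trans (sym (⊕-cancelˡ a b)) (trans (cong (a ⊕_) eq) (⊕-cancelˡ a b′))

-- Blocks, coordinates and positions on the long cycle.

-- There are at least 3 blocks, so the two neighbouring blocks of a block are distinct from it and from
-- each other, and the graph is simple.
module ShiftedCycle (m k : ℕ) where

  M N : ℕ
  M = suc (suc (suc m))
  N = suc k * M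

  Block Coord Code Vertex Port : Set
  Block  = Fin M
  Coord  = Fin (suc k)
  Code   = Fin (2 ^ suc k)
  Vertex = Block × Code
  Port   = Fin 2 × Code

  -- Abstract, because unification would otherwise unfold the arithmetic of the encodings.
  abstract
    bit : Code → Coord → Fin 2
    bit = finToFun {2} {suc k}

    code : (Coord → Fin 2) → Code
    code = funToFin

    bit-code : ∀ f → bit (code f) ≗ f
    bit-code = finToFun-funToFin

    code-ext : ∀ {f x} → f ≗ bit x → code f ≡ x
    code-ext {x = x} f≗x = trans (funToFin-cong f≗x) (funToFin-finToFin {suc k} {2} x)

    vertex-code : Fin (M * 2 ^ suc k) ↔ Vertex
    vertex-code = *↔×

    port-code : Fin (2 * 2 ^ suc k) ↔ Port
    port-code = *↔×

  -- lower i and raise i are the coordinate changes along the edges between the blocks predᶜ i and i.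
  lower raise : Block → Coord → Coord
  lower zero    = predᶜ
  lower (suc _) = λ c → c
  raise zero    = sucᶜ
  raise (suc _) = λ c → c

  lower-raise : ∀ i c → lower i (raise i c) ≡ c
  lower-raise zero    = predᶜ-sucᶜ
  lower-raise (suc _) = λ _ → refl

  raise-lower : ∀ i c → raise i (lower i c) ≡ c
  raise-lower zero    = sucᶜ-predᶜ
  raise-lower (suc _) = λ _ → refl

  pos : Block → Coord → ℕ
  pos i c = toℕ i + toℕ c * M

  -- Going down from block 0 adds `M - 1` to the block index and takes one coordinate, worth `M`,
  -- away: again a decrease by one, unless the position wraps from 0 to `N - 1`.
  pos-lower : ∀ i c → pos i c ≡ suc (pos (predᶜ i) (lower i c))
                    ⊎ (pos i c ≡ 0 × suc (pos (predᶜ i) (lower i c)) ≡ N)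
  pos-lower (suc i) c       rewrite toℕ-inject₁ i = inj₁ refl
  pos-lower zero    (suc c) rewrite toℕ-fromℕ m | toℕ-inject₁ c = inj₁ refl
  pos-lower zero    zero    rewrite toℕ-fromℕ m | toℕ-fromℕ k = inj₂ (refl , refl)

  -- p is within distance t of 0 on the cycle of length N.
  Near : ℕ → ℕ → Set
  Near t p = p ≤ t ⊎ N ≤ t + p

  near-lower : ∀ {t} i c → Near t (pos i c) → Near (suc t) (pos (predᶜ i) (lower i c))
  near-lower {t} i c near with pos-lower i c
  ... | inj₂ (_ , eq) = inj₂ (subst (_≤ suc t + pos (predᶜ i) (lower i c)) eq (s≤s (m≤n+m _ t)))
  ... | inj₁ eq with subst (Near t) eq near
  ...   | inj₁ le = inj₁ (≤-trans (n≤1+n _) (≤-trans le (n≤1+n t)))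
  ...   | inj₂ le = inj₂ (≤-trans le (≤-reflexive (+-suc t _)))

  near-raise : ∀ {t} i c → Near t (pos (predᶜ i) (lower i c)) → Near (suc t) (pos i c)
  near-raise {t} i c near with pos-lower i c
  ... | inj₂ (eq , _) = inj₁ (subst (_≤ suc t) (sym eq) z≤n)
  ... | inj₁ eq with near
  ...   | inj₁ le = inj₁ (subst (_≤ suc t) (sym eq) (s≤s le))
  ...   | inj₂ le = inj₂ (≤-trans le (+-mono-≤ (n≤1+n t) (≤-trans (n≤1+n _) (≤-reflexive (sym eq)))))

  -- Moves between neighbouring blocks.

  pattern down = zero
  pattern up   = suc zero

  -- In both directions the mask is indexed by the coordinates of the upper end of the edge, so
  -- moving back with the same mask undoes the move.
  move : Fin 2 → Code → Vertex → Vertex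
  move down b (i , x) = predᶜ i , code λ c → bit x (raise i c) ⊕ bit b (raise i c)
  move up   b (i , x) = sucᶜ i  , code λ c → bit x (lower (sucᶜ i) c) ⊕ bit b c

  -- Taking `sucᶜ j ≡ i` as a hypothesis lets `lower i` stand for `lower (sucᶜ j)`, which does not
  -- reduce when `j` is `predᶜ i`.
  up-≡ : ∀ {j i b z x} → sucᶜ j ≡ i → (∀ c → bit z (lower i c) ⊕ bit b c ≡ bit x c) → move up b (j , z) ≡ (i , x)
  up-≡ {j} refl h = cong (sucᶜ j ,_) (code-ext h)

  move-up-down : ∀ b v → move up b (move down b v) ≡ v
  move-up-down b (i , x) = up-≡ {predᶜ i} (sucᶜ-predᶜ i) λ c → begin
    bit (code λ c → bit x (raise i c) ⊕ bit b (raise i c)) (lower i c) ⊕ bit b c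
      ≡⟨ cong (_⊕ bit b c) (bit-code _ (lower i c)) ⟩
    (bit x (raise i (lower i c)) ⊕ bit b (raise i (lower i c))) ⊕ bit b c
      ≡⟨ cong (λ c′ → (bit x c′ ⊕ bit b c′) ⊕ bit b c) (raise-lower i c) ⟩
    (bit x c ⊕ bit b c) ⊕ bit b c
      ≡⟨ ⊕-cancelʳ (bit x c) (bit b c) ⟩
    bit x c ∎
    where open ≡-Reasoning

  move-down-up : ∀ b v → move down b (move up b v) ≡ v
  move-down-up b (i , x) = cong₂ _,_ (predᶜ-sucᶜ i) (code-ext λ c → begin
    bit (code λ c → bit x (lower j c) ⊕ bit b c) (raise j c) ⊕ bit b (raise j c)
      ≡⟨ cong (_⊕ bit b (raise j c)) (bit-code _ (raise j c)) ⟩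
    (bit x (lower j (raise j c)) ⊕ bit b (raise j c)) ⊕ bit b (raise j c)
      ≡⟨ ⊕-cancelʳ _ (bit b (raise j c)) ⟩
    bit x (lower j (raise j c))
      ≡⟨ cong (bit x) (lower-raise j c) ⟩
    bit x c ∎)
    where
    open ≡-Reasoning
    j = sucᶜ i

  move-opposite : ∀ d b v → move (opposite d) b (move d b v) ≡ v
  move-opposite down = move-up-down
  move-opposite up   = move-down-up

  move-irrefl : ∀ d b v → move d b v ≢ v
  move-irrefl down b (i , x) eq = predᶜ-irrefl i (,-injectiveˡ eq)
  move-irrefl up   b (i , x) eq = sucᶜ-irrefl i (,-injectiveˡ eq)

  move-direction-injective : ∀ d d′ {b b′} v → move d b v ≡ move d′ b′ v → d ≡ d′
  move-direction-injective down down v       eq = refl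
  move-direction-injective down up   (i , x) eq = contradiction (,-injectiveˡ eq) (predᶜ≢sucᶜ i)
  move-direction-injective up   down (i , x) eq = contradiction (sym (,-injectiveˡ eq)) (predᶜ≢sucᶜ i)
  move-direction-injective up   up   v       eq = refl

  code-injective : ∀ {f g} → code f ≡ code g → f ≗ g
  code-injective {f} {g} eq c = trans (sym (bit-code f c)) (trans (cong (λ x → bit x c) eq) (bit-code g c))

  bit-injective : ∀ {x y} → bit x ≗ bit y → x ≡ y
  bit-injective {x} h = trans (sym (code-ext {x = x} λ _ → refl)) (code-ext h)

  move-mask-injective : ∀ d {b b′} v → move d b v ≡ move d b′ v → b ≡ b′
  move-mask-injective down {b} {b′} (i , x) eq = bit-injective λ c → subst (λ c → bit b c ≡ bit b′ c) (raise-lower i c)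
    (⊕-injectiveʳ (bit x (raise i (lower i c))) (code-injective (,-injectiveʳ eq) (lower i c)))
  move-mask-injective up (i , x) eq = bit-injective λ c →
    ⊕-injectiveʳ (bit x (lower (sucᶜ i) c)) (code-injective (,-injectiveʳ eq) c)

  -- The graph with interchanged directions.

  twist : Vertex → Fin 2
  twist (zero  , x) = bit x zero
  twist (suc _ , x) = zero

  next : Vertex → Port → Vertex
  next v (s , b) = move (s ⊕ twist v) b v

  -- The way back is opposite to the direction actually taken, re-encoded with the twist of the node
  -- reached.
  reverse : Vertex → Port → Port
  reverse v (s , b) = opposite (s ⊕ twist v) ⊕ twist (next v (s , b)) , b

  next-reverse : ∀ v p → next (next v p) (reverse v p) ≡ v
  next-reverse v (s , b) = trans
    (cong (λ d → move d b (next v (s , b))) (⊕-cancelʳ (opposite (s ⊕ twist v)) (twist (next v (s , b)))))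
    (move-opposite (s ⊕ twist v) b v)

  next-injective : ∀ v p q → next v p ≡ next v q → p ≡ q
  next-injective v (s , b) (s′ , b′) eq
    with refl ← ⊕-injectiveˡ {s} {s′} (twist v) (move-direction-injective (s ⊕ twist v) (s′ ⊕ twist v) v eq) =
    cong (s ,_) (move-mask-injective (s ⊕ twist v) v eq)

  shiftedCycle : RegularGraph Vertex Port
  shiftedCycle = record
    { next           = next
    ; reverse        = reverse
    ; next-reverse   = next-reverse
    ; next-irrefl    = λ v (s , b) → move-irrefl (s ⊕ twist v) b v
    ; next-injective = next-injective
    }

  open Encoding shiftedCycle vertex-code port-code public

  -- Undoes the twist: the port at `v` that realises a prescribed actual direction.
  port : Fin 2 → Code → Vertex → Port
  port d b v = d ⊕ twist v , b

  next-port : ∀ d b v → next v (port d b v) ≡ move d b v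
  next-port d b v = cong (λ d → move d b v) (⊕-cancelʳ d (twist v))

  open Inverse vertex-code public using ()
    renaming (to to decode; from to encode; strictlyInverseʳ to encode-decode)

  move-step : ∀ d b v {w l} → Walk graph (encode (move d b v)) w l → Walk graph (encode v) w (suc l)
  move-step d b v {w} {l} walk =
    walk-step v (port d b v) (subst (λ u → Walk graph (encode u) w l) (sym (next-port d b v)) walk)

  -- The diameter.

  -- Consecutive blocks are completely joined: the mask is the difference between `x` and the
  -- target, pulled back to the coordinates of block `i`.
  down-onto : ∀ i x y → ∃[ b ] move down b (i , x) ≡ (predᶜ i , y)
  down-onto i x y = b , cong (predᶜ i ,_) (code-ext λ c → begin
    bit x (raise i c) ⊕ bit b (raise i c)
      ≡⟨ cong (bit x (raise i c) ⊕_) (bit-code _ (raise i c)) ⟩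
    bit x (raise i c) ⊕ (bit x (raise i c) ⊕ bit y (lower i (raise i c)))
      ≡⟨ ⊕-cancelˡ (bit x (raise i c)) _ ⟩
    bit y (lower i (raise i c))
      ≡⟨ cong (bit y) (lower-raise i c) ⟩
    bit y c ∎)
    where
    open ≡-Reasoning
    b = code λ c → bit x c ⊕ bit y (lower i c)

  -- The first step installs the final code `y`; the later steps choose masks that keep it.
  walk-down : ∀ s i x y → Walk graph (encode (i , x)) (encode (predᶜ^ (suc s) i , y)) (suc s)
  walk-down s i x y with b , eq ← down-onto i x y = move-step down b (i , x)
    (subst (λ v → Walk graph (encode v) (encode (predᶜ^ s (predᶜ i) , y)) s) (sym eq) (continue s))
    where
    continue : ∀ s → Walk graph (encode (predᶜ i , y)) (encode (predᶜ^ s (predᶜ i) , y)) s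
    continue zero    = here _
    continue (suc s) = walk-down s (predᶜ i) y y

  diameter : DiameterAtMost graph M
  diameter u v with s , s≤n , eq ← predᶜ^-transitive (proj₁ (decode u)) (proj₁ (decode v)) =
    suc s , s≤s s≤n , subst₂ (λ u v → Walk graph u v (suc s)) (encode-decode u)
      (trans (cong (λ i → encode (i , proj₂ (decode v))) eq) (encode-decode v))
      (walk-down s _ (proj₂ (decode u)) (proj₂ (decode v)))

  -- Agreement of truncated views.

  -- The graded bisimulation for `view-cong`. Position 0 is near for every `t`, so the twists agree;
  -- a move shifts positions by one, so bits near for `t` afterwards were near for `suc t` before.
  _≈[_]_ : Vertex → ℕ → Vertex → Set
  (i , x) ≈[ t ] (j , y) = i ≡ j × (∀ c → Near t (pos i c) → bit x c ≡ bit y c)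

  twist-cong : ∀ {t} u v → u ≈[ t ] v → twist u ≡ twist v
  twist-cong (zero  , x) (_ , y) (refl , x≈y) = x≈y zero (inj₁ z≤n)
  twist-cong (suc _ , x) (_ , y) (refl , x≈y) = refl

  move-cong : ∀ {t} d b u v → u ≈[ suc t ] v → move d b u ≈[ t ] move d b v
  move-cong {t} down b (i , x) (_ , y) (refl , x≈y) = refl , λ c near →
    trans (bit-code _ c) (trans
      (cong (_⊕ bit b (raise i c)) (x≈y (raise i c)
        (near-raise i (raise i c) (subst (λ c → Near t (pos (predᶜ i) c)) (sym (lower-raise i c)) near))))
      (sym (bit-code _ c)))
  move-cong {t} up b (i , x) (_ , y) (refl , x≈y) = refl , λ c near →
    trans (bit-code _ c) (trans
      (cong (_⊕ bit b c) (x≈y (lower (sucᶜ i) c)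
        (subst (λ j → Near (suc t) (pos j (lower (sucᶜ i) c))) (predᶜ-sucᶜ i) (near-lower (sucᶜ i) c near))))
      (sym (bit-code _ c)))

  ≈-step : ∀ {t} u v → u ≈[ suc t ] v → ∀ p → reverse u p ≡ reverse v p × next u p ≈[ t ] next v p
  ≈-step {t} u v u≈v (s , b) rewrite twist-cong u v u≈v =
    cong (λ d → opposite (s ⊕ twist v) ⊕ d , b) (twist-cong _ _ moved) , moved
    where
    moved : move (s ⊕ twist v) b u ≈[ t ] move (s ⊕ twist v) b v
    moved = move-cong (s ⊕ twist v) b u v u≈v

  ≈⇒view-≡ : ∀ t u v → u ≈[ t ] v → view graph t (encode u) ≡ view graph t (encode v)
  ≈⇒view-≡ t u v = view-cong {R = λ t u v → u ≈[ t ] v} (λ {_} {u} {v} → ≈-step u v) t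

  -- Recovering all coordinates from the infinite view.

  -- Both neighbouring blocks of block 0 are untwisted, so the port at the far end exposes the
  -- direction actually taken, and with it the twist.
  indistinguishable-twist : ∀ i x y → Indistinguishable (i , x) (i , y) → twist (i , x) ≡ twist (i , y)
  indistinguishable-twist (suc i) x y ind = refl
  indistinguishable-twist zero    x y ind =
    -- `opposite b` is `up ⊕ b` by definition.
    ⊕-injectiveʳ up (trans (sym (down-back x))
      (trans (,-injectiveˡ (indistinguishable-reverse ind (down , x))) (down-back y)))
    where
    down-back : ∀ z → proj₁ (reverse (zero , z) (down , x)) ≡ opposite (bit z zero)
    down-back z with bit z zero
    ... | down = refl
    ... | up   = refl

  indistinguishable-move : ∀ d b i x y → Indistinguishable (i , x) (i , y) →
    Indistinguishable (move d b (i , x)) (move d b (i , y))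
  indistinguishable-move d b i x y ind = subst₂ Indistinguishable (next-port d b (i , x))
    (trans (cong (λ s → next (i , y) (d ⊕ s , b)) (indistinguishable-twist i x y ind)) (next-port d b (i , y)))
    (indistinguishable-next ind (port d b (i , x)))

  -- Each move down lowers the position of the coordinate by one, until at position 0 the twist
  -- reveals it.
  indistinguishable-bit : ∀ n i c x y → pos i c ≡ n → Indistinguishable (i , x) (i , y) → bit x c ≡ bit y c
  indistinguishable-bit zero    zero zero x y eq ind = indistinguishable-twist zero x y ind
  indistinguishable-bit (suc n) i    c    x y eq ind with pos-lower i c
  ... | inj₂ (eq′ , _) = contradiction (trans (sym eq) eq′) λ ()
  ... | inj₁ eq′ = begin
    bit x c ≡⟨ cong (bit x) (raise-lower i c) ⟨
    bit x (raise i (lower i c)) ≡⟨ ⊕-injectiveˡ (bit x (raise i (lower i c))) moved ⟩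
    bit y (raise i (lower i c)) ≡⟨ cong (bit y) (raise-lower i c) ⟩
    bit y c ∎
    where
    open ≡-Reasoning
    -- Both nodes move with the same mask, here `x`, so its contribution cancels.
    moved = trans (sym (bit-code _ (lower i c))) (trans
      (indistinguishable-bit n (predᶜ i) (lower i c) _ _ (suc-injective (trans (sym eq′) eq))
        (indistinguishable-move down x i x y ind))
      (bit-code _ (lower i c)))

  -- Two nodes of block 0 that differ in one coordinate.

  indicator : Coord → Coord → Fin 2
  indicator c₀ c with c ≟ c₀
  ... | yes _ = up
  ... | no  _ = down

  indicator-diagonal : ∀ c₀ → indicator c₀ c₀ ≡ up
  indicator-diagonal c₀ with c₀ ≟ c₀
  ... | yes _ = refl
  ... | no c≢ = contradiction refl c≢

  origin : Vertex
  origin = zero , code λ _ → zero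

  spike : Coord → Vertex
  spike c₀ = zero , code (indicator c₀)

  origin≉spike : ∀ c₀ → ¬ Indistinguishable origin (spike c₀)
  origin≉spike c₀ ind = contradiction (begin
    zero                          ≡⟨ bit-code (λ _ → zero) c₀ ⟨
    bit (proj₂ origin) c₀         ≡⟨ indistinguishable-bit _ zero c₀ _ _ refl ind ⟩
    bit (proj₂ (spike c₀)) c₀     ≡⟨ bit-code (indicator c₀) c₀ ⟩
    indicator c₀ c₀               ≡⟨ indicator-diagonal c₀ ⟩
    suc zero                      ∎) λ ()
    where open ≡-Reasoning

  origin≈spike : ∀ t c₀ → ¬ Near t (pos zero c₀) → origin ≈[ t ] spike c₀
  origin≈spike t c₀ far = refl , λ c near → begin
    bit (proj₂ origin) c         ≡⟨ bit-code (λ _ → zero) c ⟩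
    zero                         ≡⟨ off-diagonal c near ⟩
    indicator c₀ c               ≡⟨ bit-code (indicator c₀) c ⟨
    bit (proj₂ (spike c₀)) c     ∎
    where
    open ≡-Reasoning
    off-diagonal : ∀ c → Near t (pos zero c) → zero ≡ indicator c₀ c
    off-diagonal c near with c ≟ c₀
    ... | yes refl = contradiction near far
    ... | no _     = refl

module _ (m h : ℕ) where
  open ShiftedCycle m (h + h)

  -- The middle one of the `2h + 1` coordinates. Its position `h * M` is `h * M` steps from 0 one
  -- way and `(h + 1) * M` the other way.
  antipode : Coord
  antipode = fromℕ h ↑ˡ h

  pos-antipode : pos zero antipode ≡ h * M
  pos-antipode = cong (_* M) (trans (toℕ-↑ˡ (fromℕ h) h) (toℕ-fromℕ h))

  far-antipode : ∀ {t} → t < h * M → ¬ Near t (pos zero antipode)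
  far-antipode {t} t<hM near with subst (Near t) pos-antipode near
  ... | inj₁ hM≤t = <⇒≱ t<hM hM≤t
  ... | inj₂ N≤   = <⇒≱ (+-monoˡ-< (h * M) t<hM) (begin
    h * M + h * M    ≡⟨ *-distribʳ-+ M h h ⟨
    (h + h) * M      ≤⟨ m≤n+m _ M ⟩
    N                ≤⟨ N≤ ⟩
    t + h * M        ∎)
    where open ≤-Reasoning

  slow-pair : ∃[ G ] ∃[ a ] ∃[ b ]
    (DiameterAtMost {M * 2 ^ suc (h + h)} G M
    × ¬ ((l : ℕ) → view G l a ≡ view G l b)
    × (∀ t → t < h * M → view G t a ≡ view G t b))
  slow-pair = graph , encode origin , encode (spike antipode) , diameter , origin≉spike antipode
    , λ t t<hM → ≈⇒view-≡ t origin (spike antipode) (origin≈spike t antipode (far-antipode t<hM))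

-- Choice of `h` and the time bound.

last-before-failure : {P : ℕ → Set} → (∀ h → Dec (P h)) → ∀ f a → P a → ¬ P (f + a) →
  ∃[ h ] (a ≤ h × P h × ¬ P (suc h))
last-before-failure P? zero    a Pa ¬P = contradiction Pa ¬P
last-before-failure {P} P? (suc f) a Pa ¬P with P? (suc a)
... | no ¬Psa = a , ≤-refl , Pa , ¬Psa
... | yes Psa with h , a<h , rest ← last-before-failure P? f (suc a) Psa (¬P ∘ subst P (+-suc f a)) =
  h , <⇒≤ a<h , rest

n<2^n : ∀ n → n < 2 ^ n
n<2^n zero    = s≤s z≤n
n<2^n (suc n) = begin-strict
  suc n           ≤⟨ n<2^n n ⟩
  2 ^ n           <⟨ m<m+n (2 ^ n) (m^n>0 2 n) ⟩
  2 ^ n + 2 ^ n   ≡⟨ cong (2 ^ n +_) (+-identityʳ (2 ^ n)) ⟨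
  2 ^ suc n       ∎
  where open ≤-Reasoning

^-*-swap : ∀ D e c → (D * 2 ^ e) ^ c ≡ 2 ^ (e * c) * D ^ c
^-*-swap D e c = begin
  (D * 2 ^ e) ^ c          ≡⟨ ^-distrib-* D (2 ^ e) c ⟩
  D ^ c * (2 ^ e) ^ c      ≡⟨ *-comm (D ^ c) _ ⟩
  (2 ^ e) ^ c * D ^ c      ≡⟨ cong (_* D ^ c) (^-*-assoc 2 e c) ⟩
  2 ^ (e * c) * D ^ c      ∎
  where
  open ≡-Reasoning
  ^-distrib-* : ∀ x y n → (x * y) ^ n ≡ x ^ n * y ^ n
  ^-distrib-* x y zero    = refl
  ^-distrib-* x y (suc n) = trans (cong (x * y *_) (^-distrib-* x y n))
    ([m*n]*[o*p]≡[m*o]*[n*p] x y (x ^ n) (y ^ n))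

-- As `suc h` is too large, `n < D * 2 ^ e` with `e = 2h + 3`. If `h * D ≤ t`, the `c`-th power of
-- this contradicts the time bound, because `e * c ≤ 5h * 100D ≤ 600t`.
time-bound : ∀ D n h t → 1 ≤ h → ¬ D * 2 ^ suc (suc h + suc h) ≤ n → TimeBound D n t → t < h * D
time-bound D n h t 1≤h n< (5<D , bound) = ≰⇒> λ hD≤t → <⇒≱ (^-monoˡ-< c (≰⇒> n<)) (begin
  (D * 2 ^ e) ^ c                     ≡⟨ ^-*-swap D e c ⟩
  2 ^ (e * c) * D ^ c                 ≤⟨ *-monoˡ-≤ (D ^ c) (^-monoʳ-≤ 2 (exponent hD≤t)) ⟩
  2 ^ (600 * t + 246 * D) * D ^ c     ≤⟨ bound ⟩
  n ^ c                               ∎)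
  where
  open ≤-Reasoning
  c e : ℕ
  c = 100 * (D ∸ 5)
  e = suc (suc h + suc h)
  -- Strict monotonicity of the `c`-th power requires `c` to be positive, which follows from
  -- `5 < D`.
  instance
    c≢0 : NonZero c
    c≢0 = >-nonZero (*-mono-< {0} {100} {0} (s≤s z≤n) (m<n⇒0<n∸m 5<D))
  open +-*-Solver
  e≤5h : e ≤ 5 * h
  e≤5h = begin
    e                  ≡⟨ solve 1 (λ h → con 1 :+ ((con 1 :+ h) :+ (con 1 :+ h)) := con 3 :* con 1 :+ con 2 :* h) refl h ⟩
    3 * 1 + 2 * h      ≤⟨ +-monoˡ-≤ (2 * h) (*-monoʳ-≤ 3 1≤h) ⟩
    3 * h + 2 * h      ≡⟨ *-distribʳ-+ h 3 2 ⟨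
    5 * h              ∎
  exponent : h * D ≤ t → e * c ≤ 600 * t + 246 * D
  exponent hD≤t = begin
    e * c                   ≤⟨ *-mono-≤ e≤5h (*-monoʳ-≤ 100 (m∸n≤m D 5)) ⟩
    (5 * h) * (100 * D)     ≡⟨ [m*n]*[o*p]≡[m*o]*[n*p] 5 h 100 D ⟩
    500 * (h * D)           ≤⟨ *-mono-≤ (m≤m+n 500 100) hD≤t ⟩
    600 * t                 ≤⟨ m≤m+n (600 * t) (246 * D) ⟩
    600 * t + 246 * D       ∎

maximal-half-length : ∀ D n .{{_ : NonZero D}} → D * 2 ^ 12 ≤ 3 * n →
  ∃[ h ] (1 ≤ h × D * 2 ^ suc (h + h) ≤ n × ¬ D * 2 ^ suc (suc h + suc h) ≤ n)
maximal-half-length D n D2^12≤3n =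
  -- The search starts at 1, as `e ≤ 5 * h` requires, and ends at `n + 1`, where the power of two
  -- exceeds `n`.
  last-before-failure (λ h → D * 2 ^ suc (h + h) ≤? n) n 1 fits (<⇒≱ exceeds)
  where
  open ≤-Reasoning
  fits : D * 2 ^ 3 ≤ n
  fits = *-cancelˡ-≤ 3 (begin
    3 * (D * 2 ^ 3)   ≡⟨ *-comm 3 (D * 2 ^ 3) ⟩
    D * 2 ^ 3 * 3     ≡⟨ *-assoc D (2 ^ 3) 3 ⟩
    -- `2 ^ 12 = 24 + 4072`.
    D * 24            ≤⟨ *-monoʳ-≤ D (m≤m+n 24 4072) ⟩
    D * 2 ^ 12        ≤⟨ D2^12≤3n ⟩
    3 * n             ∎)
  exceeds : n < D * 2 ^ suc ((n + 1) + (n + 1))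
  exceeds = begin-strict
    n                                  <⟨ n<2^n n ⟩
    2 ^ n                              ≤⟨ ^-monoʳ-≤ 2 (≤-trans (m≤m+n n 1) (≤-trans (m≤m+n (n + 1) (n + 1)) (n≤1+n _))) ⟩
    2 ^ suc ((n + 1) + (n + 1))        ≤⟨ m≤n*m _ D ⟩
    D * 2 ^ suc ((n + 1) + (n + 1))    ∎

theorem3p1 : (D' n' : ℕ) → 3 ≤ D' → 1 ≤ n' → D' * 2 ^ 12 ≤ 3 * n' →
    ∃[ n ] ∃[ G ] ∃[ a ] ∃[ b ]
    (n ≤ n' × Connected {n} G × DiameterAtMost G D'
    × ¬ ((l : ℕ) → view G l a ≡ view G l b)
    × ((t : ℕ) → TimeBound D' n' t → view G t a ≡ view G t b))
theorem3p1 D@(suc (suc (suc m))) n' (s≤s (s≤s (s≤s _))) _ D2^12≤3n' =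
  let h , 1≤h , size≤n' , maximal = maximal-half-length D n' D2^12≤3n'
      G , a , b , diameter , distinct , agree = slow-pair m h
  in _ , G , a , b , size≤n' , (λ u v → let k , _ , walk = diameter u v in k , walk) , diameter , distinct
       , λ t bound → agree t (time-bound D n' h t 1≤h maximal bound)
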